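{- For every positive integer $n$, the simplified graph of overlapping permutations $SP(n)$ is word-representable.
   Context: Graph of overlapping permutations: for a positive integer $n$, $P(n)$ is the directed graph whose vertex set is the set of all $n!$ permutations of $\{1,2,\ldots,n\}$ (written as words $x_1x_2\ldots x_n$), with an arc from $x_1x_2\ldots x_n$ to $y_1y_2\ldots y_n$ if and only if for all $2\le i<j\le n$ either both $x_i<x_j$ and $y_{i-1}<y_{j-1}$ hold, or both $x_i>x_j$ and $y_{i-1}>y_{j-1}$ hold (loops may occur). The simplified graph of overlapping permutations $SP(n)$ is the simple undirected graph obtained from $P(n)$ by removing orientations and loops and replacing multiple edges between a pair of vertices by a single edge. That is, two distinct permutations are adjacent in $SP(n)$ if and only if there is an arc of $P(n)$ between them in at least one direction. Word-representability: two distinct letters $x$ and $y$ alternate in a word $w$ if, after deleting from $w$ all letters other than the copies of $x$ and $y$, one obtains either a word $xyxy\cdots$ or a word $yxyx\cdots$ (of even or odd length). A simple graph $G=(V,E)$ is word-representable if there exists a (finite) word $w$ over the alphabet $V$, in which every letter of $V$ occurs, such that for all $x\ne y$ in $V$, the letters $x$ and $y$ alternate in $w$ if and only if $xy\in E$. -}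

module Defs where

open import Data.Fin using (Fin; toℕ; pred; _<_)
import Data.Fin.Properties as Fin
open import Data.List using (List; []; _∷_; filter)
open import Data.List.Membership.Propositional using (_∈_)
open import Data.Nat using (ℕ; _≤_)
open import Data.Product using (_×_; _,_; ∃-syntax)
open import Data.Sum using (_⊎_; swap)
open import Data.Vec using (Vec; lookup)
open import Data.Vec.Properties using (≡-dec)
open import Data.Vec.Relation.Unary.Unique.Propositional using (Unique)
open import Function using (_∘_; _⇔_)
open import Relation.Binary.Core using (Rel)
open import Relation.Binary.Definitions using (DecidableEquality; Irreflexive; Symmetric)
open import Relation.Binary.PropositionalEquality using (_≡_; _≢_; refl; cong; sym)
open import Relation.Nullary.Decidable using (map′; _⊎-dec_)
open import Level using (0ℓ)

-- Vertices carry decidable equality so that letters can be deleted from words.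

record Digraph : Set₁ where
  field
    Vertex : Set
    _≟_    : DecidableEquality Vertex
    Arc    : Rel Vertex 0ℓ

record SimpleGraph : Set₁ where
  field
    Vertex     : Set
    _≟_        : DecidableEquality Vertex
    Adj        : Rel Vertex 0ℓ
    adj-sym    : Symmetric Adj
    adj-irrefl : Irreflexive _≡_ Adj

simplify : Digraph → SimpleGraph
simplify D = record
  { Vertex     = Vertex
  ; _≟_        = _≟_
  ; Adj        = λ x y → x ≢ y × (Arc x y ⊎ Arc y x)
  ; adj-sym    = λ (x≢y , a) → x≢y ∘ sym , swap a
  ; adj-irrefl = λ x≡y (x≢y , _) → x≢y x≡y
  }
  where open Digraph D

-- The word x₁…xₙ of a permutation, with positions and values 1,…,n represented
-- by the elements 0,…,n-1 of Fin n.  The proof of distinctness is irrelevant,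
-- so _≡_ on Perm n is equality of words.

record Perm (n : ℕ) : Set where
  constructor perm
  field
    word      : Vec (Fin n) n
    .distinct : Unique word

  infix 9 _!_

  _!_ : Fin n → Fin n
  _!_ = lookup word

open Perm public using (_!_)

_≟ᴾ_ : ∀ {n} → DecidableEquality (Perm n)
perm v p ≟ᴾ perm w q =
  map′ (λ { refl → refl }) (cong Perm.word) (≡-dec Fin._≟_ v w)

-- The bound 2 ≤ i on positions reads 1 ≤ toℕ i here, since positions start
-- at 0; under it, pred i is the position immediately before i.

P : ℕ → Digraph
P n = record
  { Vertex = Perm n
  ; _≟_    = _≟ᴾ_
  ; Arc    = λ x y → ∀ (i j : Fin n) → 1 ≤ toℕ i → i < j →
               (x ! i < x ! j × y ! pred i < y ! pred j) ⊎
               (x ! j < x ! i × y ! pred j < y ! pred i)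
  }

SP : ℕ → SimpleGraph
SP n = simplify (P n)

-- Alternating x y w: w is a (possibly empty) finite word xyxy⋯.

data Alternating {A : Set} : A → A → List A → Set where
  []  : ∀ {x y} → Alternating x y []
  _∷_ : ∀ x {y w} → Alternating y x w → Alternating x y (x ∷ w)

module _ (G : SimpleGraph) where
  open SimpleGraph G

  restrict : Vertex → Vertex → List Vertex → List Vertex
  restrict x y = filter (λ z → (z ≟ x) ⊎-dec (z ≟ y))

  Alternate : Vertex → Vertex → List Vertex → Set
  Alternate x y w =
    Alternating x y (restrict x y w) ⊎ Alternating y x (restrict x y w)

  WordRepresentable : Set
  WordRepresentable =
    ∃[ w ] (∀ x → x ∈ w) × (∀ x y → x ≢ y → Alternate x y w ⇔ Adj x y)

{-# OPTIONS --safe #-}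

-- SP(n) is 3-colourable: the descent word of a permutation maps arcs of P(n) to shifts of binary
-- words, and a binary word is coloured by the letter of its initial run when that run has odd
-- length and by a third colour when it is even.  Shifting either shortens the initial run by one
-- or changes its letter, so colours differ except for constant words, each of which is the
-- descent word of a single permutation.
--
-- Every finite 3-colourable graph is word-representable.  If A, B, C list the colour classes, all
-- differently coloured pairs alternate in ABCABC, whatever the order inside each occurrence of a
-- class.  For a non-edge uv there is such a word, or one obtained from it by transposing
-- consecutive letters u and v, in which the restriction to u and v has two equal consecutive
-- letters; concatenating these words over all non-edges breaks exactly the non-edges.

module Submission where

open import Defs
open import Data.Bool using (Bool; true; false; if_then_else_)
open import Data.Fin using (Fin; zero; suc; toℕ; fromℕ; inject₁; opposite; pred; _<_)
open import Data.Fin.Induction using (<-weakInduction; >-weakInduction)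
open import Data.Fin.Patterns using (0F; 1F; 2F)
import Data.Fin.Properties as Fin
open import Data.List
  using (List; []; _∷_; [_]; _++_; _∷ʳ_; filter; concatMap; tabulate; deduplicate;
         cartesianProduct; cartesianProductWith; allFin)
open import Data.List.Membership.Propositional using (_∈_; lose)
open import Data.List.Membership.Propositional.Properties
  using (∈-∃++; ∈-filter⁺; ∈-filter⁻; ∈-++⁺ˡ; ∈-concatMap⁺; ∈-cartesianProduct⁺;
         ∈-cartesianProductWith⁺; ∈-allFin; ∈-deduplicate⁺)
open import Data.List.Properties
  using (filter-accept; filter-reject; filter-none; filter-++; filter-≐; ++-assoc; ++-identityʳ;
         ∷-injectiveʳ; tabulate-cong)
open import Data.List.Relation.Binary.Permutation.Propositional
  using (_↭_; ↭-refl; ↭-trans; ↭-sym; ↭-reflexive)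
open import Data.List.Relation.Binary.Permutation.Propositional.Properties
  using (↭-singleton-inv; ↭-empty-inv; shift; filter-↭; ∷↭∷ʳ)
open import Data.List.Relation.Unary.All as All using (All; []; _∷_)
import Data.List.Relation.Unary.All.Properties as All
open import Data.List.Relation.Unary.Any using (here; there)
import Data.List.Relation.Unary.Unique.DecPropositional.Properties as UniqueDec
open import Data.List.Relation.Unary.Unique.Propositional using (Unique; _∷_)
import Data.List.Relation.Unary.Unique.Propositional.Properties as Unique
open import Data.Nat as ℕ using (ℕ; zero; suc; s≤s; z≤n; NonZero)
import Data.Nat.Properties as ℕ
open import Data.Product using (_×_; _,_; proj₁; proj₂; ∃-syntax)
open import Data.Sum using (_⊎_; inj₁; inj₂; swap)
open import Data.Vec using (Vec; []; _∷_)
open import Data.Vec.Properties using (tabulate∘lookup) renaming (tabulate-cong to tabulateⱽ-cong)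
open import Data.Vec.Relation.Unary.AllPairs using (allPairs?)
open import Data.Vec.Relation.Unary.Unique.Propositional using () renaming (Unique to Uniqueⱽ)
open import Data.Vec.Relation.Unary.Unique.Propositional.Properties using (lookup-injective)
open import Function using (_∘_; mk⇔)
open import Relation.Binary.Definitions using (Decidable; tri<; tri≈; tri>)
open import Relation.Binary.PropositionalEquality
  using (_≡_; _≢_; refl; sym; trans; cong; cong₂; subst; subst₂)
open import Relation.Nullary using (¬_; Dec; yes; no; contradiction; contradiction-irr)
open import Relation.Nullary.Decidable as Dec
  using (_×-dec_; _⊎-dec_; _→-dec_; ¬?; does; recompute)
import Relation.Unary as Pred

-- Words of 3-colourable graphs

private variable
  A : Set
  x y z : A
  xs ys : List A

filter-singleton : {P : A → Set} (P? : Pred.Decidable P) → Unique xs → x ∈ xs → P x →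
                   (∀ {z} → z ∈ xs → P z → z ≡ x) → filter P? xs ≡ [ x ]
filter-singleton P? (x∉xs ∷ _) (here refl) px only =
  trans (filter-accept P? px) (cong (_ ∷_) (filter-none P? (All.tabulate λ z∈ pz →
    All.lookup x∉xs z∈ (sym (only (there z∈) pz)))))
filter-singleton P? (z∉xs ∷ u) (there x∈xs) px only =
  trans (filter-reject P? λ pz → All.lookup z∉xs x∈xs (only (here refl) pz))
        (filter-singleton P? u x∈xs px (only ∘ there))

-- The filter sees the order of `x` and `y` only if it keeps both, and then they are equal.
filter-swap : {P : A → Set} (P? : Pred.Decidable P) → (P x → P y → x ≡ y) →
              filter P? (x ∷ y ∷ xs) ≡ filter P? (y ∷ x ∷ xs)
filter-swap {x = x} {y = y} P? coincide with P? x in ex | P? y in ey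
... | yes px | yes py with refl ← coincide px py rewrite ex = refl
... | yes _  | no _   rewrite ex | ey = refl
... | no _   | yes _  rewrite ex | ey = refl
... | no _   | no _   rewrite ex | ey = refl

-- Two equal consecutive letters: an obstruction to alternation that survives concatenation on
-- either side.
data HasSquare {A : Set} : List A → Set where
  here  : HasSquare (x ∷ x ∷ xs)
  there : HasSquare xs → HasSquare (x ∷ xs)

square-++ˡ : ∀ (xs : List A) → HasSquare ys → HasSquare (xs ++ ys)
square-++ˡ []       sq = sq
square-++ˡ (_ ∷ xs) sq = there (square-++ˡ xs sq)

square-++ʳ : HasSquare xs → HasSquare (xs ++ ys)
square-++ʳ here       = here
square-++ʳ (there sq) = there (square-++ʳ sq)

alternating⇒squareFree : x ≢ y → Alternating x y xs → ¬ HasSquare xs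
alternating⇒squareFree x≢y (_ ∷ (_ ∷ _)) here       = x≢y refl
alternating⇒squareFree x≢y (_ ∷ alt)     (there sq) = alternating⇒squareFree (x≢y ∘ sym) alt sq

∈⇒↭∷ : x ∈ xs → ∃[ ys ] x ∷ ys ↭ xs
∈⇒↭∷ x∈xs with ps , qs , refl ← ∈-∃++ x∈xs = ps ++ qs , ↭-sym (shift _ ps qs)

∈⇒↭∷ʳ : x ∈ xs → ∃[ ys ] ys ++ [ x ] ↭ xs
∈⇒↭∷ʳ x∈xs with ys , p ← ∈⇒↭∷ x∈xs = ys , ↭-trans (↭-sym (∷↭∷ʳ _ ys)) p

-- Three colours in cyclic order.

Colour : Set
Colour = Fin 3

next : Colour → Colour
next 0F = 1F
next 1F = 2F
next 2F = 0F

-- Distinct colours are neighbours on a cycle of length three, so non-edges fall into two cases up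
-- to symmetry.
≡⊎next : ∀ i j → i ≡ j ⊎ j ≡ next i ⊎ i ≡ next j
≡⊎next 0F 0F = inj₁ refl
≡⊎next 0F 1F = inj₂ (inj₁ refl)
≡⊎next 0F 2F = inj₂ (inj₂ refl)
≡⊎next 1F 0F = inj₂ (inj₂ refl)
≡⊎next 1F 1F = inj₁ refl
≡⊎next 1F 2F = inj₂ (inj₁ refl)
≡⊎next 2F 0F = inj₂ (inj₁ refl)
≡⊎next 2F 1F = inj₂ (inj₂ refl)
≡⊎next 2F 2F = inj₁ refl

next≢ : ∀ i → i ≢ next i
next≢ 0F ()
next≢ 1F ()
next≢ 2F ()

-- Two rounds, so that every pair `i`, `next i`, including `2F`, `0F`, occurs consecutively with a
-- further `i` behind it.
twice : List Colour
twice = 0F ∷ 1F ∷ 2F ∷ 0F ∷ 1F ∷ 2F ∷ []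

-- Cuts of `twice` at its first `i`: `after₂` follows the pair `i`, `next i`, while `between` and
-- `after₁` surround the second `i`.
before after₁ after₂ between : Colour → List Colour
before 0F = []
before 1F = 0F ∷ []
before 2F = 0F ∷ 1F ∷ []
after₂ 0F = 2F ∷ 0F ∷ 1F ∷ 2F ∷ []
after₂ 1F = 0F ∷ 1F ∷ 2F ∷ []
after₂ 2F = 1F ∷ 2F ∷ []
between i = next i ∷ next (next i) ∷ []
after₁ 0F = 1F ∷ 2F ∷ []
after₁ 1F = 2F ∷ []
after₁ 2F = []

twice-consecutive : ∀ i → before i ++ i ∷ next i ∷ after₂ i ≡ twice
twice-consecutive 0F = refl
twice-consecutive 1F = refl
twice-consecutive 2F = refl

twice-repeated : ∀ i → before i ++ i ∷ between i ++ i ∷ after₁ i ≡ twice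
twice-repeated 0F = refl
twice-repeated 1F = refl
twice-repeated 2F = refl

∉between : ∀ i → All (i ≢_) (between i)
∉between 0F = (λ ()) ∷ (λ ()) ∷ []
∉between 1F = (λ ()) ∷ (λ ()) ∷ []
∉between 2F = (λ ()) ∷ (λ ()) ∷ []

-- For `x` and `y` of distinct colours `a` and `b`, this is the restriction of any word listing
-- colour classes: only the sequence of colours matters.
trace : Colour → Colour → A → A → List Colour → List A
trace a b x y = concatMap λ i → if does (a Fin.≟ i) then [ x ] else
                                if does (b Fin.≟ i) then [ y ] else []

trace-twice : ∀ {a b} (x y : A) → a < b → trace a b x y twice ≡ x ∷ y ∷ x ∷ y ∷ []
trace-twice {a = 0F} {1F} _ _ _ = refl
trace-twice {a = 0F} {2F} _ _ _ = refl
trace-twice {a = 1F} {2F} _ _ _ = refl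
trace-twice {a = 0F} {0F} _ _ ()
trace-twice {a = 1F} {0F} _ _ ()
trace-twice {a = 1F} {1F} _ _ (s≤s ())
trace-twice {a = 2F} {0F} _ _ ()
trace-twice {a = 2F} {1F} _ _ (s≤s ())
trace-twice {a = 2F} {2F} _ _ (s≤s (s≤s ()))

-- After `i`, `next i`, the first of these two colours to recur is `i`; this supplies the second
-- letter of the square `uu`.
trace-after₂ : ∀ i (x y : A) → ∃[ zs ] trace i (next i) x y (after₂ i) ≡ x ∷ zs
trace-after₂ 0F x y = _ , refl
trace-after₂ 1F x y = _ , refl
trace-after₂ 2F x y = _ , refl

module ThreeColourable
  (G : SimpleGraph) (adj? : Decidable (SimpleGraph.Adj G))
  (vs : List (SimpleGraph.Vertex G)) (unique : Unique vs) (complete : ∀ x → x ∈ vs)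
  (colour : SimpleGraph.Vertex G → Colour)
  (proper : ∀ {x y} → SimpleGraph.Adj G x y → colour x ≢ colour y)
  where

  open SimpleGraph G

  private variable
    u v : Vertex
    is js : List Colour
    p q w : List Vertex

  class : Colour → List Vertex
  class i = filter (λ z → colour z Fin.≟ i) vs

  ∈-class : ∀ x → x ∈ class (colour x)
  ∈-class x = ∈-filter⁺ (λ z → colour z Fin.≟ colour x) (complete x) refl

  class-colour : ∀ {i} → x ∈ class i → colour x ≡ i
  class-colour {i = i} x∈ = proj₂ (∈-filter⁻ (λ z → colour z Fin.≟ i) {xs = vs} x∈)

  class-unique : ∀ i → Unique (class i)
  class-unique i = Unique.filter⁺ (λ z → colour z Fin.≟ i) unique

  -- Each class may be listed in any order, which leaves room to put a chosen letter at the border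
  -- of its block.
  data Arranged : List Colour → List Vertex → Set where
    []  : Arranged [] []
    _∷_ : ∀ {i} → q ↭ class i → Arranged is w → Arranged (i ∷ is) (q ++ w)

  arranged : ∀ is → Arranged is (concatMap class is)
  arranged []       = []
  arranged (i ∷ is) = ↭-refl ∷ arranged is

  arranged-++ : Arranged is p → Arranged js q → Arranged (is ++ js) (p ++ q)
  arranged-++ []                        r = r
  arranged-++ (_∷_ {q = q′} {w = w} s t) r =
    subst (Arranged _) (sym (++-assoc q′ w _)) (s ∷ arranged-++ t r)

  module _ (x y : Vertex) where
    letter? : Pred.Decidable (λ z → z ≡ x ⊎ z ≡ y)
    letter? z = (z ≟ x) ⊎-dec (z ≟ y)

    restrict-++ : ∀ p q → restrict G x y (p ++ q) ≡ restrict G x y p ++ restrict G x y q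
    restrict-++ = filter-++ letter?

    restrict-↭ : p ↭ q → restrict G x y p ↭ restrict G x y q
    restrict-↭ = filter-↭ letter?

    restrict-absent : ∀ {i} → q ↭ class i → colour x ≢ i → colour y ≢ i → restrict G x y q ≡ []
    restrict-absent {i = i} q↭ x≢ y≢ = ↭-empty-inv (↭-trans (restrict-↭ q↭) (↭-reflexive
      (filter-none letter? (All.tabulate λ { z∈ (inj₁ refl) → x≢ (class-colour z∈)
                                           ; z∈ (inj₂ refl) → y≢ (class-colour z∈) }))))

    -- In its class `x` is the only letter kept, and a permutation of a singleton is that singleton,
    -- so the order of `q` disappears.
    restrict-left : colour x ≢ colour y → q ↭ class (colour x) → restrict G x y q ≡ [ x ]
    restrict-left x≢y q↭ = ↭-singleton-inv (↭-trans (restrict-↭ q↭) (↭-reflexive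
      (filter-singleton letter? (class-unique _) (∈-class x) (inj₁ refl)
        λ { _ (inj₁ refl) → refl ; z∈ (inj₂ refl) → contradiction (sym (class-colour z∈)) x≢y })))

    restrict-right : colour x ≢ colour y → q ↭ class (colour y) → restrict G x y q ≡ [ y ]
    restrict-right x≢y q↭ = ↭-singleton-inv (↭-trans (restrict-↭ q↭) (↭-reflexive
      (filter-singleton letter? (class-unique _) (∈-class y) (inj₂ refl)
        λ { z∈ (inj₁ refl) → contradiction (class-colour z∈) x≢y ; _ (inj₂ refl) → refl })))

    restrict-arranged : colour x ≢ colour y → Arranged is w →
                        restrict G x y w ≡ trace (colour x) (colour y) x y is
    restrict-arranged x≢y [] = refl
    restrict-arranged x≢y (_∷_ {q = q} {w = w} {i = i} q↭ r) =
      trans (restrict-++ q w) (cong₂ _++_ slot (restrict-arranged x≢y r))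
      where
      slot : restrict G x y q ≡ (if does (colour x Fin.≟ i) then [ x ] else
                                 if does (colour y Fin.≟ i) then [ y ] else [])
      slot with colour x Fin.≟ i | colour y Fin.≟ i
      ... | yes refl | _        = restrict-left x≢y q↭
      ... | no _     | yes refl = restrict-right x≢y q↭
      ... | no x≢i   | no y≢i   = restrict-absent q↭ x≢i y≢i

    -- Covers two letters of the same colour, about which `restrict-arranged` says nothing.
    restrict-arranged-absent : All (colour x ≢_) is → All (colour y ≢_) is → Arranged is w →
                               restrict G x y w ≡ []
    restrict-arranged-absent [] [] [] = refl
    restrict-arranged-absent (x≢ ∷ xs) (y≢ ∷ ys) (_∷_ {q = q} {w = w} q↭ r) =
      trans (restrict-++ q w)
            (cong₂ _++_ (restrict-absent q↭ x≢ y≢) (restrict-arranged-absent xs ys r))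

  restrict-sym : ∀ x y w → restrict G x y w ≡ restrict G y x w
  restrict-sym x y w = filter-≐ (letter? x y) (letter? y x) (swap , swap) w

  -- Were distinct `u` and `v` both kept, they would be the ends of the edge `xy`; so an edge cannot
  -- see the transposition of a non-edge.
  restrict-swap : ∀ p → ¬ Adj u v → Adj x y →
                  restrict G x y (p ++ u ∷ v ∷ q) ≡ restrict G x y (p ++ v ∷ u ∷ q)
  restrict-swap {u} {v} {x} {y} {q} p ¬uv xy =
    trans (restrict-++ x y p (u ∷ v ∷ q))
      (trans (cong (restrict G x y p ++_) (filter-swap (letter? x y) coincide))
             (sym (restrict-++ x y p (v ∷ u ∷ q))))
    where
    coincide : u ≡ x ⊎ u ≡ y → v ≡ x ⊎ v ≡ y → u ≡ v
    coincide (inj₁ refl) (inj₁ refl) = refl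
    coincide (inj₂ refl) (inj₂ refl) = refl
    coincide (inj₁ refl) (inj₂ refl) = contradiction xy ¬uv
    coincide (inj₂ refl) (inj₁ refl) = contradiction (adj-sym xy) ¬uv

  -- The restriction of w to an edge is a power of xy, where x has the smaller colour; stated
  -- through its effect as a prefix, which composes under _++_.
  Respects : List Vertex → Set
  Respects w = ∀ {x y} → Adj x y → colour x < colour y → ∀ {s} →
               Alternating x y s → Alternating x y (restrict G x y w ++ s)

  respects-[] : Respects []
  respects-[] _ _ alt = alt

  respects-++ : ∀ p → Respects p → Respects q → Respects (p ++ q)
  respects-++ {q} p rp rq {x} {y} xy lt {s} alt = subst (Alternating x y)
    (trans (sym (++-assoc (restrict G x y p) (restrict G x y q) s))
           (cong (_++ s) (sym (restrict-++ x y p q))))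
    (rp xy lt (rq xy lt alt))

  respects-concatMap : (f : A → List Vertex) → (∀ a → Respects (f a)) →
                       ∀ as → Respects (concatMap f as)
  respects-concatMap f r []       = respects-[]
  respects-concatMap f r (a ∷ as) = respects-++ (f a) (r a) (respects-concatMap f r as)

  arranged⇒respects : Arranged twice w → Respects w
  arranged⇒respects r {x} {y} xy lt {s} alt = subst (λ t → Alternating x y (t ++ s))
    (sym (trans (restrict-arranged x y (proper xy) r) (trace-twice x y lt)))
    (x ∷ (y ∷ (x ∷ (y ∷ alt))))

  respects-swap : ∀ p → ¬ Adj u v → Respects (p ++ u ∷ v ∷ q) → Respects (p ++ v ∷ u ∷ q)
  respects-swap p ¬uv r {x} {y} xy lt {s} alt =
    subst (λ t → Alternating x y (t ++ s)) (restrict-swap p ¬uv xy) (r xy lt alt)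

  Separates : Vertex → Vertex → List Vertex → Set
  Separates u v w = HasSquare (restrict G u v w)

  separates-++ˡ : ∀ p → Separates u v q → Separates u v (p ++ q)
  separates-++ˡ {u} {v} {q} p sq =
    subst HasSquare (sym (restrict-++ u v p q)) (square-++ˡ (restrict G u v p) sq)

  separates-++ʳ : ∀ p → Separates u v p → Separates u v (p ++ q)
  separates-++ʳ {u} {v} {q} p sq =
    subst HasSquare (sym (restrict-++ u v p q)) (square-++ʳ sq)

  separates-concatMap : (f : A → List Vertex) → ∀ {a as} → a ∈ as →
                        Separates u v (f a) → Separates u v (concatMap f as)
  separates-concatMap f {a} (here refl) sq = separates-++ʳ (f a) sq
  separates-concatMap f {as = b ∷ _} (there a∈) sq =
    separates-++ˡ (f b) (separates-concatMap f a∈ sq)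

  -- Listing u last in one copy of its class and first in the next produces the square uu.
  separate-sameColour : ∀ u v → colour u ≡ colour v → ∃[ w ] Respects w × Separates u v w
  separate-sameColour u v u≡v
    with X , X↭ ← ∈⇒↭∷ʳ (∈-class u) | Y , Y↭ ← ∈⇒↭∷ (∈-class u) =
      B ++ (X ++ [ u ]) ++ M ++ (u ∷ Y) ++ E
    , arranged⇒respects tour
    , separates-++ˡ B (subst (Separates u v) (sym (++-assoc X [ u ] _)) (separates-++ˡ X square))
    where
    i = colour u
    B = concatMap class (before i)
    M = concatMap class (between i)
    E = concatMap class (after₁ i)

    tour : Arranged twice (B ++ (X ++ [ u ]) ++ M ++ (u ∷ Y) ++ E)
    tour = subst (λ is → Arranged is (B ++ (X ++ [ u ]) ++ M ++ (u ∷ Y) ++ E)) (twice-repeated i)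
      (arranged-++ (arranged (before i))
        (X↭ ∷ arranged-++ (arranged (between i)) (Y↭ ∷ arranged (after₁ i))))

    square : ∀ {t} → Separates u v (u ∷ M ++ u ∷ t)
    square {t} = subst HasSquare (sym (trans (filter-accept (letter? u v) (inj₁ refl)) (cong (u ∷_)
      (trans (restrict-++ u v M (u ∷ t)) (cong₂ _++_
        -- No class in `M` has the common colour of `u` and `v`, so nothing is kept between the two
        -- copies of `u`.
        (restrict-arranged-absent u v (∉between i)
          (subst (λ j → All (j ≢_) (between i)) u≡v (∉between i)) (arranged (between i)))
        (filter-accept (letter? u v) (inj₁ refl))))))) here

  -- Transposing u and v at the border of their classes turns …uv…u… into …vu…u…, where no v is
  -- left between the two occurrences of u.
  separate-nextColour : ∀ u v → ¬ Adj u v → colour v ≡ next (colour u) →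
                        ∃[ w ] Respects w × Separates u v w
  separate-nextColour u v ¬uv v≡next
    with X , X↭ ← ∈⇒↭∷ʳ (∈-class u) | Y , Y↭ ← ∈⇒↭∷ (∈-class v) =
      (B ++ X) ++ v ∷ u ∷ Y ++ E
    , respects-swap (B ++ X) ¬uv (subst Respects reassociate (arranged⇒respects tour))
    , separates-++ˡ (B ++ X) square
    where
    i = colour u
    B = concatMap class (before i)
    E = concatMap class (after₂ i)
    u≢v : colour u ≢ colour v
    u≢v eq = next≢ i (trans eq v≡next)

    tour : Arranged twice (B ++ (X ++ [ u ]) ++ (v ∷ Y) ++ E)
    tour = subst (λ is → Arranged is (B ++ (X ++ [ u ]) ++ (v ∷ Y) ++ E)) (twice-consecutive i)
      (arranged-++ (arranged (before i))
        (X↭ ∷ subst (λ j → v ∷ Y ↭ class j) v≡next Y↭ ∷ arranged (after₂ i)))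

    reassociate : B ++ (X ++ [ u ]) ++ (v ∷ Y) ++ E ≡ (B ++ X) ++ u ∷ v ∷ Y ++ E
    reassociate = trans (cong (B ++_) (++-assoc X [ u ] _)) (sym (++-assoc B X _))

    -- The whole class of `v` restricts to `v` alone, which is already the letter in front of `Y`.
    restrict-Y : restrict G u v Y ≡ []
    restrict-Y = ∷-injectiveʳ (trans (sym (filter-accept (letter? u v) {v} {Y} (inj₂ refl)))
                                     (restrict-right u v u≢v Y↭))

    restrict-E : ∃[ t ] restrict G u v E ≡ u ∷ t
    restrict-E with t , eq ← trace-after₂ i u v =
      t , trans (restrict-arranged u v u≢v (arranged (after₂ i)))
                (trans (cong (λ j → trace i j u v (after₂ i)) v≡next) eq)

    restrict-uYE : restrict G u v (u ∷ Y ++ E) ≡ u ∷ u ∷ proj₁ restrict-E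
    restrict-uYE = trans (filter-accept (letter? u v) (inj₁ refl)) (cong (u ∷_)
      (trans (restrict-++ u v Y E) (cong₂ _++_ restrict-Y (proj₂ restrict-E))))

    square : Separates u v (v ∷ u ∷ Y ++ E)
    square = separates-++ˡ [ v ] (subst HasSquare (sym restrict-uYE) here)

  separate : ∀ u v → ¬ Adj u v → ∃[ w ] Respects w × Separates u v w
  separate u v ¬uv with ≡⊎next (colour u) (colour v)
  ... | inj₁ u≡v           = separate-sameColour u v u≡v
  ... | inj₂ (inj₁ v≡next) = separate-nextColour u v ¬uv v≡next
  ... | inj₂ (inj₂ u≡next) with w , r , sq ← separate-nextColour v u (¬uv ∘ adj-sym) u≡next =
    w , r , subst HasSquare (restrict-sym v u w) sq

  -- Edges get the empty word, so that the concatenation can run over all pairs of vertices.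
  separator : ∀ ((u , v) : Vertex × Vertex) → ∃[ w ] Respects w × (¬ Adj u v → Separates u v w)
  separator (u , v) with adj? u v
  ... | yes uv = [] , respects-[] , contradiction uv
  ... | no ¬uv with w , r , sq ← separate u v ¬uv = w , r , λ _ → sq

  plain separators : List Vertex
  plain = concatMap class twice
  separators = concatMap (proj₁ ∘ separator) (cartesianProduct vs vs)

  wordRepresentable : WordRepresentable G
  wordRepresentable =
    plain ++ separators , occurs , λ x y x≢y → mk⇔ (adjacent x y x≢y) (alternate x y)
    where
    twice-∋ : ∀ i → i ∈ twice
    twice-∋ 0F = here refl
    twice-∋ 1F = there (here refl)
    twice-∋ 2F = there (there (here refl))

    occurs : ∀ x → x ∈ plain ++ separators
    occurs x = ∈-++⁺ˡ (∈-concatMap⁺ class (lose (twice-∋ (colour x)) (∈-class x)))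

    respects : Respects (plain ++ separators)
    respects = respects-++ plain (arranged⇒respects (arranged twice))
      (respects-concatMap (proj₁ ∘ separator) (proj₁ ∘ proj₂ ∘ separator) (cartesianProduct vs vs))

    separates : ∀ x y → ¬ Adj x y → Separates x y (plain ++ separators)
    separates x y ¬xy = separates-++ˡ plain (separates-concatMap (proj₁ ∘ separator)
      (∈-cartesianProduct⁺ (complete x) (complete y)) (proj₂ (proj₂ (separator (x , y))) ¬xy))

    ascending : ∀ x y → Adj x y → colour x < colour y →
                Alternating x y (restrict G x y (plain ++ separators))
    ascending x y xy lt = subst (Alternating x y) (++-identityʳ _) (respects xy lt [])

    alternate : ∀ x y → Adj x y → Alternate G x y (plain ++ separators)
    alternate x y xy with Fin.<-cmp (colour x) (colour y)
    ... | tri< lt _ _ = inj₁ (ascending x y xy lt)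
    ... | tri≈ _ eq _ = contradiction eq (proper xy)
    ... | tri> _ _ gt = inj₂ (subst (Alternating y x)
      (restrict-sym y x (plain ++ separators)) (ascending y x (adj-sym xy) gt))

    adjacent : ∀ x y → x ≢ y → Alternate G x y (plain ++ separators) → Adj x y
    adjacent x y x≢y alt with adj? x y | alt
    ... | yes xy | _       = xy
    -- The square rules out alternation from either starting letter.
    ... | no ¬xy | inj₁ a = contradiction (separates x y ¬xy) (alternating⇒squareFree x≢y a)
    ... | no ¬xy | inj₂ a = contradiction (separates x y ¬xy) (alternating⇒squareFree (x≢y ∘ sym) a)

-- Colouring binary words by their initial runs

letter : Bool → Colour
letter false = 0F
letter true  = 1F

-- Effect on the colour of prepending `a`: an odd initial run of `a` becomes even; otherwise `a`
-- starts a new run or makes an even one odd.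
step : Bool → Colour → Colour
step a t = if does (t Fin.≟ letter a) then 2F else letter a

letter≢2F : ∀ a → letter a ≢ 2F
letter≢2F false ()
letter≢2F true  ()

letter-injective : ∀ {a b} → letter a ≡ letter b → a ≡ b
letter-injective {false} {false} _ = refl
letter-injective {true}  {true}  _ = refl

only-2F : ∀ {c} t → t ≢ letter c → (∀ {a} → t ≡ letter a → a ≡ c) → t ≡ 2F
only-2F 0F t≢ h = contradiction (cong letter (h {false} refl)) t≢
only-2F 1F t≢ h = contradiction (cong letter (h {true} refl)) t≢
only-2F 2F t≢ h = refl

step-letter : ∀ a t {b} → step a t ≡ letter b → b ≡ a
step-letter a t {b} eq with t Fin.≟ letter a
... | yes _ = contradiction (sym eq) (letter≢2F b)
... | no _  = sym (letter-injective eq)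

step-2F : ∀ a t → step a t ≡ 2F → t ≡ letter a
step-2F a t eq with t Fin.≟ letter a
... | yes t≡ = t≡
... | no _   = contradiction eq (letter≢2F a)

step-from-2F : ∀ a → step a 2F ≡ letter a
step-from-2F false = refl
step-from-2F true  = refl

step-inv : ∀ a t b u → step a t ≡ step b u →
           (t ≡ letter a × u ≡ letter b) ⊎ (a ≡ b × t ≢ letter a × u ≢ letter b)
step-inv a t b u eq with t Fin.≟ letter a | u Fin.≟ letter b
... | yes t≡ | yes u≡ = inj₁ (t≡ , u≡)
... | yes _  | no _   = contradiction (sym eq) (letter≢2F b)
... | no _   | yes _  = contradiction eq (letter≢2F a)
... | no t≢  | no u≢  = inj₂ (letter-injective eq , t≢ , u≢)

-- The colour is 2 if the initial run has even length, and the letter of that run otherwise.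
runColour : List Bool → Colour
runColour []      = 2F
runColour (a ∷ s) = step a (runColour s)

-- A colour that is a letter is the first letter of the word; `s` is nonempty, since the empty word
-- has colour 2, and so begins like `s ++ r`.
runColour-head : ∀ {a b} s r → runColour s ≡ letter b → runColour (s ++ r) ≡ letter a → a ≡ b
runColour-head {b = b} [] r eq _ = contradiction (sym eq) (letter≢2F b)
runColour-head (c ∷ s) r eq eq′ =
  trans (step-letter c (runColour (s ++ r)) eq′) (sym (step-letter c (runColour s) eq))

-- Induction on `s`: both cases of `step-inv` force `c` to be `a` and the colours of `c ∷ s` and
-- `s ∷ʳ b` to agree, which is the hypothesis for the shorter word.
runColour-shift : ∀ a s b → runColour (a ∷ s) ≡ runColour (s ∷ʳ b) → All (_≡ a) (s ∷ʳ b)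
runColour-shift a [] b eq with refl ← step-letter b 2F {a} (trans (sym eq) (step-from-2F a)) = refl ∷ []
runColour-shift a (c ∷ s) b eq with step-inv a (runColour (c ∷ s)) c (runColour (s ∷ʳ b)) eq
... | inj₁ (p≡a , q≡c) with refl ← step-letter c (runColour s) p≡a =
  refl ∷ runColour-shift c s b (trans p≡a (sym q≡c))
... | inj₂ (refl , p≢a , q≢a) = refl ∷ runColour-shift c s b (trans p≡2 (sym q≡2))
  where
  p≡2 : runColour (c ∷ s) ≡ 2F
  p≡2 = only-2F _ p≢a (step-letter c (runColour s))
  q≡2 : runColour (s ∷ʳ b) ≡ 2F
  -- Colour 2 of `c ∷ s` means that `s` has colour `letter c`, so `s ∷ʳ b` also begins with `c`.
  q≡2 = only-2F _ q≢a (runColour-head s [ b ] (step-2F c (runColour s) p≡2))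

tabulate-∷ʳ : {A : Set} {n : ℕ} (f : Fin (suc n) → A) →
              tabulate f ≡ tabulate (f ∘ inject₁) ∷ʳ f (fromℕ n)
tabulate-∷ʳ {n = zero}  f = refl
tabulate-∷ʳ {n = suc n} f = cong (f zero ∷_) (tabulate-∷ʳ (f ∘ suc))

-- Strictly monotone self-maps of a finite chain.

module _ {n : ℕ} (f : Fin (suc n) → Fin (suc n)) (increasing : ∀ k → f (inject₁ k) < f (suc k)) where

  increasing⇒≥ : ∀ i → toℕ i ℕ.≤ toℕ (f i)
  increasing⇒≥ = <-weakInduction (λ i → toℕ i ℕ.≤ toℕ (f i)) z≤n λ k ih →
    ℕ.≤-trans (s≤s (subst (ℕ._≤ toℕ (f (inject₁ k))) (Fin.toℕ-inject₁ k) ih)) (increasing k)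

  increasing⇒≤ : ∀ i → toℕ (f i) ℕ.≤ toℕ i
  increasing⇒≤ = >-weakInduction (λ i → toℕ (f i) ℕ.≤ toℕ i)
    (subst (toℕ (f (fromℕ n)) ℕ.≤_) (sym (Fin.toℕ-fromℕ n)) (ℕ.s≤s⁻¹ (Fin.toℕ<n (f (fromℕ n)))))
    λ k ih → subst (toℕ (f (inject₁ k)) ℕ.≤_) (sym (Fin.toℕ-inject₁ k))
      (ℕ.s≤s⁻¹ (ℕ.≤-trans (increasing k) ih))

  -- Values rise by at least one per step: counting up from the bottom and down from the top gives
  -- bounds that meet.
  increasing⇒id : ∀ i → f i ≡ i
  increasing⇒id i = Fin.toℕ-injective (ℕ.≤-antisym (increasing⇒≤ i) (increasing⇒≥ i))

opposite-anti : ∀ {n} {i j : Fin n} → i < j → opposite j < opposite i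
opposite-anti {n} {i} {j} i<j =
  subst₂ ℕ._<_ (sym (Fin.opposite-prop j)) (sym (Fin.opposite-prop i))
    (ℕ.∸-monoʳ-< (s≤s i<j) (Fin.toℕ<n j))

-- Composing with the order reversal `opposite` reduces this to the increasing case.
decreasing⇒opposite : ∀ {n} (f : Fin (suc n) → Fin (suc n)) → (∀ k → f (suc k) < f (inject₁ k)) →
                      ∀ i → f i ≡ opposite i
decreasing⇒opposite f decreasing i = trans (sym (Fin.opposite-involutive (f i)))
  (cong opposite (increasing⇒id (opposite ∘ f) (opposite-anti ∘ decreasing) i))

-- Permutations and their descent words.

unique? : ∀ {n} → (v : Vec (Fin n) n) → Dec (Uniqueⱽ v)
unique? = allPairs? λ i j → ¬? (i Fin.≟ j)

-- The proof of distinctness is irrelevant; deciding distinctness recovers a usable one.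
!-injective : ∀ {n} (x : Perm n) i j → x ! i ≡ x ! j → i ≡ j
!-injective (perm v d) = lookup-injective (recompute (unique? v) d)

!-extensional : ∀ {n} (x y : Perm n) → (∀ i → x ! i ≡ y ! i) → x ≡ y
!-extensional (perm v _) (perm w _) eq
  with refl ← trans (sym (tabulate∘lookup v)) (trans (tabulateⱽ-cong eq) (tabulate∘lookup w)) = refl

module _ {n : ℕ} where
  descent : Perm (suc n) → Fin n → Bool
  descent x k = does (x ! suc k Fin.<? x ! inject₁ k)

  descents : Perm (suc n) → List Bool
  descents x = tabulate (descent x)

  descent⇒> : ∀ x k → descent x k ≡ true → x ! suc k < x ! inject₁ k
  descent⇒> x k eq with x ! suc k Fin.<? x ! inject₁ k
  ... | yes x> = x>
  ... | no x≯  =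
    contradiction (trans (sym eq) (Dec.dec-false (x ! suc k Fin.<? x ! inject₁ k) x≯)) λ ()

  -- Neighbouring letters are distinct, so where there is no descent there is an ascent.
  ascent⇒< : ∀ x k → descent x k ≡ false → x ! inject₁ k < x ! suc k
  ascent⇒< x k eq with Fin.<-cmp (x ! inject₁ k) (x ! suc k)
  ... | tri< x< _ _ = x<
  ... | tri≈ _ x≡ _ = contradiction (!-injective x _ _ x≡) (Fin.<⇒≢ (Fin.≤̄⇒inject₁< ℕ.≤-refl))
  ... | tri> _ _ x> =
    contradiction (trans (sym eq) (Dec.dec-true (x ! suc k Fin.<? x ! inject₁ k) x>)) λ ()

  monotone-word : Bool → Fin (suc n) → Fin (suc n)
  monotone-word false i = i
  monotone-word true  i = opposite i

  constant⇒monotone : ∀ a x → All (_≡ a) (descents x) → ∀ i → x ! i ≡ monotone-word a i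
  constant⇒monotone false x c = increasing⇒id (x !_) λ k → ascent⇒< x k (All.tabulate⁻ c k)
  constant⇒monotone true  x c = decreasing⇒opposite (x !_) λ k → descent⇒> x k (All.tabulate⁻ c k)

  constant⇒≡ : ∀ a x y → All (_≡ a) (descents x) → All (_≡ a) (descents y) → x ≡ y
  constant⇒≡ a x y cx cy = !-extensional x y λ i →
    trans (constant⇒monotone a x cx i) (sym (constant⇒monotone a y cy i))

  colour : Perm (suc n) → Colour
  colour = runColour ∘ descents

arc⇒overlap : ∀ {n} (x y : Perm (suc (suc n))) → Digraph.Arc (P _) x y →
              ∀ k → descent x (suc k) ≡ descent y (inject₁ k)
arc⇒overlap x y arc k
  -- Neighbouring positions `k + 1` and `k + 2` of `x`, which `pred` sends to `k` and `k + 1` of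
  -- `y`.
  with arc (suc (inject₁ k)) (suc (suc k)) (s≤s z≤n) (s≤s (Fin.≤̄⇒inject₁< ℕ.≤-refl))
... | inj₁ (x< , y<) = trans (Dec.dec-false (_ Fin.<? _) (Fin.<-asym x<))
                            (sym (Dec.dec-false (_ Fin.<? _) (Fin.<-asym y<)))
... | inj₂ (x> , y>) = trans (Dec.dec-true (_ Fin.<? _) x>)
                            (sym (Dec.dec-true (_ Fin.<? _) y>))

arc⇒≢colour : ∀ {n} (x y : Perm (suc n)) → x ≢ y → Digraph.Arc (P _) x y → colour x ≢ colour y
-- Permutations of one letter have the empty descent word, which is constant for either choice of
-- letter.
arc⇒≢colour {zero}  x y x≢y arc _  = x≢y (constant⇒≡ false x y [] [])
arc⇒≢colour {suc n} x y x≢y arc eq =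
  -- The descent words are `a ∷ s` and `s ∷ʳ b`; equal colours make both constant with letter `a`.
  x≢y (constant⇒≡ a x y (refl ∷ All.++⁻ˡ s all) (subst (All (_≡ a)) (sym shifted) all))
  where
  a = descent x zero
  s = tabulate (descent x ∘ suc)
  b = descent y (fromℕ n)
  shifted : descents y ≡ s ∷ʳ b
  shifted = trans (tabulate-∷ʳ (descent y)) (cong (_∷ʳ b) (sym (tabulate-cong (arc⇒overlap x y arc))))
  all : All (_≡ a) (s ∷ʳ b)
  all = runColour-shift a s b (trans eq (cong runColour shifted))

proper : ∀ {n} {x y : Perm (suc n)} → SimpleGraph.Adj (SP (suc n)) x y → colour x ≢ colour y
proper {x = x} {y} (x≢y , inj₁ xy) = arc⇒≢colour x y x≢y xy
proper {x = x} {y} (x≢y , inj₂ yx) = arc⇒≢colour y x (x≢y ∘ sym) yx ∘ sym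

-- Decidability of adjacency and enumeration of permutations.

arc? : ∀ {n} → Decidable (Digraph.Arc (P n))
arc? x y = Fin.all? λ i → Fin.all? λ j → (1 ℕ.≤? toℕ i) →-dec (i Fin.<? j) →-dec
  (((x ! i Fin.<? x ! j) ×-dec (y ! pred i Fin.<? y ! pred j)) ⊎-dec
  ((x ! j Fin.<? x ! i) ×-dec (y ! pred j Fin.<? y ! pred i)))

adj? : ∀ {n} → Decidable (SimpleGraph.Adj (SP n))
adj? x y = ¬? (x ≟ᴾ y) ×-dec (arc? x y ⊎-dec arc? y x)

vectors : ∀ m n → List (Vec (Fin m) n)
vectors m zero    = [ [] ]
vectors m (suc n) = cartesianProductWith _∷_ (allFin m) (vectors m n)

∈-vectors : ∀ {m n} (v : Vec (Fin m) n) → v ∈ vectors m n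
∈-vectors []      = here refl
∈-vectors (i ∷ v) = ∈-cartesianProductWith⁺ _∷_ (∈-allFin i) (∈-vectors v)

permsOf : ∀ {n} → Vec (Fin n) n → List (Perm n)
permsOf v with unique? v
... | yes d = [ perm v d ]
... | no _  = []

∈-permsOf : ∀ {n} (x : Perm n) → x ∈ permsOf (Perm.word x)
∈-permsOf (perm v d) with unique? v
-- The two distinctness proofs may differ, but irrelevance makes the permutations equal.
... | yes _ = here refl
... | no ¬d = contradiction-irr d ¬d

-- Deduplication supplies the uniqueness that `ThreeColourable` asks of the vertex list.
perms : ∀ n → List (Perm n)
perms n = deduplicate _≟ᴾ_ (concatMap permsOf (vectors n n))

∈-perms : ∀ {n} (x : Perm n) → x ∈ perms n
∈-perms x = ∈-deduplicate⁺ _≟ᴾ_ (∈-concatMap⁺ permsOf (lose (∈-vectors (Perm.word x)) (∈-permsOf x)))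

theorem4 : (n : ℕ) → .{{_ : NonZero n}} → WordRepresentable (SP n)
theorem4 n@(suc _) = ThreeColourable.wordRepresentable (SP n) adj? (perms n)
  (UniqueDec.deduplicate-! _≟ᴾ_ (concatMap permsOf (vectors n n))) ∈-perms colour proper
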